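{- Let $\varphi=\frac{1+\sqrt5}{2}$ be the golden ratio and let $(F_n)_{n\ge1}$ be the Fibonacci numbers with $F_1=F_2=1$ and $F_{n+1}=F_n+F_{n-1}$. For $n\in\mathbb{N}_{>0}$ let $\sigma_{F_n}\in S_{F_n}$ be the Kronecker permutation associated with $(\{k\varphi\})_{k=1}^{F_n}$, i.e. the unique permutation of $\{1,\dots,F_n\}$ with $\{\sigma_{F_n}(1)\varphi\}<\{\sigma_{F_n}(2)\varphi\}<\dots<\{\sigma_{F_n}(F_n)\varphi\}$. Then: (1) If $n$ is even, the cycle decomposition of $\sigma_{F_n}$ consists only of 2-cycles and fixed points. (2) If $n\equiv 1$ or $n\equiv 5 \pmod 6$, the cycle decomposition of $\sigma_{F_n}$ consists of cycles of length 4 and exactly one fixed point. (3) If $n\equiv 3 \pmod 6$, the cycle decomposition of $\sigma_{F_n}$ consists of cycles of length 4 and exactly one cycle of length 2.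
   Context: For real $x$, $\{x\}=x-\lfloor x\rfloor$ denotes the fractional part. For an irrational $\alpha>0$ and $N\in\mathbb{N}$, the $N$ numbers $\{k\alpha\}$, $1\le k\le N$, are distinct, and the Kronecker permutation $\sigma_N\in S_N$ is defined by ordering them increasingly: $\{\sigma_N(1)\alpha\}<\dots<\{\sigma_N(N)\alpha\}$. Cycle lengths refer to the disjoint cycle decomposition of the permutation (a fixed point is a cycle of length 1). -}

module Defs where

open import Data.Empty using (⊥; ⊥-elim)
open import Data.Fin.Base as Fin using (Fin; toℕ)
open import Data.Fin.Permutation using (Permutation′; _⟨$⟩ʳ_)
open import Data.Integer.Base as ℤ using (ℤ; +_; -[1+_])
import Data.Integer.Properties as ℤ
open import Data.Nat.Base as ℕ using (ℕ; zero; suc)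
import Data.Nat.Coprimality as Coprimality
open import Data.Nat.Divisibility using (_∣_; divides)
open import Data.Nat.GeneralisedArithmetic using (fold)
open import Data.Nat.Primality using (Prime; prime?; euclidsLemma)
import Data.Nat.Properties as ℕ
import Data.Nat.Solver as ℕSolver
open import Data.Product.Base using (_×_; _,_; ∃; ∃-syntax; proj₁; proj₂)
open import Data.Rational.Base
open import Data.Rational.Literals using (fromℤ)
open import Data.Rational.Properties
open import Data.Rational.Solver using (module +-*-Solver)
import Data.Rational.Unnormalised.Base as ℚᵘ
open import Data.Sum.Base using (_⊎_; inj₁; inj₂; [_,_]′)
open import Relation.Binary.Definitions using (tri<; tri≈; tri>)
open import Relation.Binary.PropositionalEquality using (_≡_; _≢_; refl; sym; trans; cong; cong₂; subst; subst₂; module ≡-Reasoning)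
open import Relation.Nullary using (¬_; yes; no)
open import Relation.Nullary.Decidable using (from-yes)

-- Real numbers as two-sided Dedekind cuts: lower q means q < x and
-- upper q means x < q.
record ℝ : Set₁ where
  field
    lower upper     : ℚ → Set
    lower-inhabited : ∃ lower
    upper-inhabited : ∃ upper
    lower-closed    : ∀ {q r} → q < r → lower r → lower q
    upper-closed    : ∀ {q r} → q < r → upper q → upper r
    lower-open      : ∀ {q} → lower q → ∃[ r ] q < r × lower r
    upper-open      : ∀ {q} → upper q → ∃[ r ] r < q × upper r
    disjoint        : ∀ {q} → lower q → ¬ upper q
    located         : ∀ {q r} → q < r → lower q ⊎ upper r

open ℝ

infix 4 _<ᵣ_

_<ᵣ_ : ℝ → ℝ → Set
x <ᵣ y = ∃[ q ] upper x q × lower y q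

-- Irrationality in its constructive form: x is apart from every rational.
Irrational : ℝ → Set
Irrational x = ∀ q → lower x q ⊎ upper x q

infixl 6 _+ᵣ_ _-ᵣ_
infixr 7 _·ᵣ_

module _ (a b : ℚ) where
  open +-*-Solver

  a+b-b : (a + b) - b ≡ a
  a+b-b = solve 2 (λ a b → (a :+ b) :- b := a) refl a b

  a-b+b : (a - b) + b ≡ a
  a-b+b = solve 2 (λ a b → (a :- b) :+ b := a) refl a b

1/⁺ : (p : ℚ) .{{_ : Positive p}} → ℚ
1/⁺ p = (1/ p) {{pos⇒nonZero p}}

module _ (a p : ℚ) .{{_ : Positive p}} where

  a*p/p : (a * p) * 1/⁺ p ≡ a
  a*p/p = trans (*-assoc a p _)
            (trans (cong (a *_) (*-inverseʳ p {{pos⇒nonZero p}})) (*-identityʳ a))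

  a/p*p : (a * 1/⁺ p) * p ≡ a
  a/p*p = trans (*-assoc a _ p)
            (trans (cong (a *_) (*-inverseˡ p {{pos⇒nonZero p}})) (*-identityʳ a))

-- The translate x + b of a real x by a rational b: q < x + b iff q - b < x.
_+ᵣ_ : ℝ → ℚ → ℝ
x +ᵣ b = record
  { lower           = λ q → lower x (q - b)
  ; upper           = λ q → upper x (q - b)
  ; lower-inhabited = let q , l = lower-inhabited x in q + b , back (lower x) l
  ; upper-inhabited = let q , u = upper-inhabited x in q + b , back (upper x) u
  ; lower-closed    = λ q<r → lower-closed x (+-monoˡ-< (- b) q<r)
  ; upper-closed    = λ q<r → upper-closed x (+-monoˡ-< (- b) q<r)
  ; lower-open      = λ {q} l → let r , q-b<r , l′ = lower-open x l in
      r + b , subst (_< r + b) (a-b+b q b) (+-monoˡ-< b q-b<r) , back (lower x) l′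
  ; upper-open      = λ {q} u → let r , r<q-b , u′ = upper-open x u in
      r + b , subst (r + b <_) (a-b+b q b) (+-monoˡ-< b r<q-b) , back (upper x) u′
  ; disjoint        = disjoint x
  ; located         = λ q<r → located x (+-monoˡ-< (- b) q<r)
  }
  where
  back : ∀ (P : ℚ → Set) {q} → P q → P ((q + b) - b)
  back P {q} = subst P (sym (a+b-b q b))

_-ᵣ_ : ℝ → ℚ → ℝ
x -ᵣ b = x +ᵣ (- b)

-- The multiple p · x of a real x by a positive rational p:
-- q < p · x iff q / p < x.
_·ᵣ_ : (p : ℚ) .{{_ : Positive p}} → ℝ → ℝ
p ·ᵣ x = record
  { lower           = λ q → lower x (q * 1/⁺ p)
  ; upper           = λ q → upper x (q * 1/⁺ p)
  ; lower-inhabited = let q , l = lower-inhabited x in q * p , back (lower x) l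
  ; upper-inhabited = let q , u = upper-inhabited x in q * p , back (upper x) u
  ; lower-closed    = λ q<r → lower-closed x (mono q<r)
  ; upper-closed    = λ q<r → upper-closed x (mono q<r)
  ; lower-open      = λ {q} l → let r , q/p<r , l′ = lower-open x l in
      r * p , subst (_< r * p) (a/p*p q p) (*-monoˡ-<-pos p q/p<r) , back (lower x) l′
  ; upper-open      = λ {q} u → let r , r<q/p , u′ = upper-open x u in
      r * p , subst (r * p <_) (a/p*p q p) (*-monoˡ-<-pos p r<q/p) , back (upper x) u′
  ; disjoint        = disjoint x
  ; located         = λ q<r → located x (mono q<r)
  }
  where
  back : ∀ (P : ℚ → Set) {q} → P q → P ((q * p) * 1/⁺ p)
  back P {q} = subst P (sym (a*p/p q p))

  mono : ∀ {q r} → q < r → q * 1/⁺ p < r * 1/⁺ p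
  mono = *-monoˡ-<-pos (1/⁺ p) {{1/pos⇒pos p}}

+ᵣ-irrational : ∀ x b → Irrational x → Irrational (x +ᵣ b)
+ᵣ-irrational x b irr q = irr (q - b)

·ᵣ-irrational : ∀ p .{{_ : Positive p}} x → Irrational x → Irrational (p ·ᵣ x)
·ᵣ-irrational p x irr q = irr (q * 1/⁺ p)

-- m ≤ x < m + 1
IsFloor : ℝ → ℤ → Set
IsFloor x m = ¬ upper x (fromℤ m) × upper x (fromℤ (ℤ.suc m))

floorOf : ∀ x → Irrational x → ∃ (IsFloor x)
floorOf x irr =
  let q , l = lower-inhabited x
      r , u = upper-inhabited x
      a     = -[1+ ℤ.∣ ↥ q ∣ ]
      b     = + suc ℤ.∣ ↥ r ∣
      d     = ℤ.∣ b ℤ.- a ∣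
  in search d a (lower-closed x (below q) l)
       (subst (λ z → upper x (fromℤ z)) (sym (a+[b-a]≡b ℤ.∣ ↥ q ∣ ℤ.∣ ↥ r ∣))
         (upper-closed x (above r) u))
  where
  n<[1+n]*d : ∀ n d → n ℕ.< suc n ℕ.* suc d
  n<[1+n]*d n d = ℕ.m≤m*n (suc n) (suc d)

  below : ∀ q → fromℤ -[1+ ℤ.∣ ↥ q ∣ ] < q
  below (mkℚ (+ n) d c)    = *<* (subst (λ z → -[1+ n ] ℤ.* + suc d ℤ.< z)
    (sym (ℤ.*-identityʳ (+ n))) ℤ.-<+)
  below (mkℚ -[1+ n ] d c) = *<* (subst (λ z → -[1+ suc n ] ℤ.* + suc d ℤ.< z)
    (sym (ℤ.*-identityʳ -[1+ n ])) (ℤ.-<- (ℕ.s≤s⁻¹ (n<[1+n]*d (suc n) d))))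

  above : ∀ q → q < fromℤ (+ suc ℤ.∣ ↥ q ∣)
  above (mkℚ (+ n) d c)    = *<* (subst (λ z → z ℤ.< + suc n ℤ.* + suc d)
    (sym (ℤ.*-identityʳ (+ n))) (ℤ.+<+ (n<[1+n]*d n d)))
  above (mkℚ -[1+ n ] d c) = *<* (subst (λ z → z ℤ.< + suc (suc n) ℤ.* + suc d)
    (sym (ℤ.*-identityʳ -[1+ n ])) ℤ.-<+)

  a+[b-a]≡b : ∀ m n → -[1+ m ] ℤ.+ + ℤ.∣ + suc n ℤ.- -[1+ m ] ∣ ≡ + suc n
  a+[b-a]≡b m n = trans (ℤ.+-comm -[1+ m ] (+ suc n ℤ.- -[1+ m ]))
    (trans (ℤ.+-assoc (+ suc n) (+ suc m) -[1+ m ])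
      (trans (cong (λ z → + suc n ℤ.+ z) (ℤ.+-inverseʳ (+ suc m))) (ℤ.+-identityʳ (+ suc n))))

  search : ∀ d a → lower x (fromℤ a) → upper x (fromℤ (a ℤ.+ + d)) → ∃ (IsFloor x)
  search zero    a l u = ⊥-elim (disjoint x l (subst (λ z → upper x (fromℤ z)) (ℤ.+-identityʳ a) u))
  search (suc d) a l u with irr (fromℤ (ℤ.suc a))
  ... | inj₂ u′ = a , disjoint x l , u′
  ... | inj₁ l′ = search d (ℤ.suc a) l′ (subst (λ z → upper x (fromℤ z)) (shift a (+ d)) u)
    where
    shift : ∀ a b → a ℤ.+ (+ 1 ℤ.+ b) ≡ (+ 1 ℤ.+ a) ℤ.+ b
    shift a b = trans (sym (ℤ.+-assoc a (+ 1) b)) (cong (ℤ._+ b) (ℤ.+-comm a (+ 1)))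

floorᵣ : ∀ x → Irrational x → ℤ
floorᵣ x irr = proj₁ (floorOf x irr)

-- The fractional part of an irrational x. Only irrational arguments are
-- needed, and for these the floor is computable.
fracPartᵣ : ∀ x → Irrational x → ℝ
fracPartᵣ x irr = x -ᵣ fromℤ (floorᵣ x irr)

5ℚ 20ℚ : ℚ
5ℚ  = fromℤ (+ 5)
20ℚ = fromℤ (+ 20)

0<* : ∀ {p q} → 0ℚ < p → 0ℚ < q → 0ℚ < p * q
0<* {p} {q} 0<p 0<q = positive⁻¹ (p * q) {{pos*pos⇒pos p {{positive 0<p}} q {{positive 0<q}}}}

0<q-p : ∀ {p q} → p < q → 0ℚ < q - p
0<q-p {p} {q} p<q = subst (_< q - p) (+-inverseʳ p) (+-monoˡ-< (- p) p<q)

p<p+q : ∀ {p q} → 0ℚ < q → p < p + q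
p<p+q {p} {q} 0<q = subst (_< p + q) (+-identityʳ p) (+-monoʳ-< p 0<q)

square-mono : ∀ {q r} → 0ℚ ≤ q → q < r → q * q < r * r
square-mono {q} {r} 0≤q q<r = ≤-<-trans
  (*-monoˡ-≤-nonNeg q {{nonNegative 0≤q}} (<⇒≤ q<r))
  (*-monoˡ-<-pos r {{positive (≤-<-trans 0≤q q<r)}} q<r)

-- r = 5(q+1)/(q+5) lies strictly between q and √5.
module Step (q : ℚ) (0≤q : 0ℚ ≤ q) where
  open ≡-Reasoning
  open +-*-Solver

  c : ℚ
  c = q + 5ℚ

  0<c : 0ℚ < c
  0<c = ≤-<-trans 0≤q (p<p+q (positive⁻¹ 5ℚ))

  i : ℚ
  i = 1/⁺ c {{positive 0<c}}

  0<i : 0ℚ < i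
  0<i = positive⁻¹ i {{1/pos⇒pos c {{positive 0<c}}}}

  c*i≡1 : c * i ≡ 1ℚ
  c*i≡1 = *-inverseʳ c {{pos⇒nonZero c {{positive 0<c}}}}

  r : ℚ
  r = 5ℚ * (q + 1ℚ) * i

  0<r : 0ℚ < r
  0<r = 0<* (0<* (positive⁻¹ 5ℚ) (≤-<-trans 0≤q (p<p+q (positive⁻¹ 1ℚ)))) 0<i

  r-lower : q + (5ℚ - q * q) * i ≡ r
  r-lower = begin
    q + (5ℚ - q * q) * i             ≡⟨ cong (_+ (5ℚ - q * q) * i) (*-identityʳ q) ⟨
    q * 1ℚ + (5ℚ - q * q) * i        ≡⟨ cong (λ e → q * e + (5ℚ - q * q) * i) c*i≡1 ⟨
    q * (c * i) + (5ℚ - q * q) * i   ≡⟨ solve 2 (λ q i → q :* ((q :+ con 5ℚ) :* i) :+ (con 5ℚ :- q :* q) :* i := con 5ℚ :* (q :+ con 1ℚ) :* i) refl q i ⟩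
    r                                ∎

  r-upper : r + (q * q - 5ℚ) * i ≡ q
  r-upper = begin
    r + (q * q - 5ℚ) * i   ≡⟨ solve 2 (λ q i → con 5ℚ :* (q :+ con 1ℚ) :* i :+ (q :* q :- con 5ℚ) :* i := q :* ((q :+ con 5ℚ) :* i)) refl q i ⟩
    q * (c * i)            ≡⟨ cong (q *_) c*i≡1 ⟩
    q * 1ℚ                 ≡⟨ *-identityʳ q ⟩
    q                      ∎

  5[ci]²≡5 : 5ℚ * ((c * i) * (c * i)) ≡ 5ℚ
  5[ci]²≡5 = cong (λ e → 5ℚ * (e * e)) c*i≡1

  r²-lower : r * r + 20ℚ * ((5ℚ - q * q) * (i * i)) ≡ 5ℚ
  r²-lower = trans
    (solve 2 (λ q i → (con 5ℚ :* (q :+ con 1ℚ) :* i) :* (con 5ℚ :* (q :+ con 1ℚ) :* i)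
                        :+ con 20ℚ :* ((con 5ℚ :- q :* q) :* (i :* i))
                      := con 5ℚ :* (((q :+ con 5ℚ) :* i) :* ((q :+ con 5ℚ) :* i))) refl q i)
    5[ci]²≡5

  r²-upper : 5ℚ + 20ℚ * ((q * q - 5ℚ) * (i * i)) ≡ r * r
  r²-upper = trans (cong (_+ 20ℚ * ((q * q - 5ℚ) * (i * i))) (sym 5[ci]²≡5))
    (solve 2 (λ q i → con 5ℚ :* (((q :+ con 5ℚ) :* i) :* ((q :+ con 5ℚ) :* i))
                        :+ con 20ℚ :* ((q :* q :- con 5ℚ) :* (i :* i))
                      := (con 5ℚ :* (q :+ con 1ℚ) :* i) :* (con 5ℚ :* (q :+ con 1ℚ) :* i)) refl q i)

q²≢5 : ∀ q → q * q ≢ 5ℚ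
q²≢5 q@(mkℚ n d-1 coprime) q²≡5 = no-solution eqℕ
  where
  d = suc d-1
  m = ℤ.∣ n ∣

  eqᵘ : toℚᵘ 5ℚ ℚᵘ.≃ toℚᵘ q ℚᵘ.* toℚᵘ q
  eqᵘ = subst (λ z → toℚᵘ z ℚᵘ.≃ toℚᵘ q ℚᵘ.* toℚᵘ q) q²≡5 (toℚᵘ-homo-* q q)

  eqℤ : + 5 ℤ.* (+ (d ℕ.* d)) ≡ n ℤ.* n ℤ.* + 1
  eqℤ with ℚᵘ.*≡* e ← eqᵘ = e

  eqℕ : m ℕ.* m ≡ 5 ℕ.* (d ℕ.* d)
  eqℕ = trans (sym (ℤ.abs-* n n))
    (trans (cong ℤ.∣_∣ (sym (trans eqℤ (ℤ.*-identityʳ (n ℤ.* n))))) (ℤ.abs-* (+ 5) (+ (d ℕ.* d))))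

  5-prime : Prime 5
  5-prime = from-yes (prime? 5)

  root : ∀ k → 5 ∣ k ℕ.* k → 5 ∣ k
  root k h = [ (λ x → x) , (λ x → x) ]′ (euclidsLemma k k 5-prime h)

  [k*5]² : ∀ k → (k ℕ.* 5) ℕ.* (k ℕ.* 5) ≡ 5 ℕ.* (k ℕ.* k ℕ.* 5)
  [k*5]² = solve 1 (λ k → (k :* con 5) :* (k :* con 5) := con 5 :* (k :* k :* con 5)) refl
    where
    open ℕSolver.+-*-Solver

  no-solution : m ℕ.* m ≡ 5 ℕ.* (d ℕ.* d) → ⊥
  no-solution e with root m (divides (d ℕ.* d) (trans e (ℕ.*-comm 5 (d ℕ.* d))))
  ... | 5∣m@(divides k m≡k*5)
    with root d (divides (k ℕ.* k) (sym (ℕ.*-cancelˡ-≡ (k ℕ.* k ℕ.* 5) (d ℕ.* d) 5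
           (trans (sym (trans (cong₂ ℕ._*_ m≡k*5 m≡k*5)
             ([k*5]² k))) e))))
  ... | 5∣d with () ← Coprimality.recompute coprime (5∣m , 5∣d)

√5-trichotomy : ∀ q → (q < 0ℚ ⊎ q * q < 5ℚ) ⊎ (0ℚ < q × 5ℚ < q * q)
√5-trichotomy q with <-cmp q 0ℚ | <-cmp (q * q) 5ℚ
... | tri< q<0 _ _  | _              = inj₁ (inj₁ q<0)
... | tri≈ _ q≡0 _  | tri< q²<5 _ _  = inj₁ (inj₂ q²<5)
... | tri> _ _ _    | tri< q²<5 _ _  = inj₁ (inj₂ q²<5)
... | tri> _ _ 0<q  | tri> _ _ 5<q²  = inj₂ (0<q , 5<q²)
... | tri≈ _ refl _ | tri> _ _ (*<* (ℤ.+<+ ()))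
... | _             | tri≈ _ q²≡5 _  = ⊥-elim (q²≢5 q q²≡5)

√5 : ℝ
√5 = record
  { lower           = Lower
  ; upper           = Upper
  ; lower-inhabited = 0ℚ , inj₂ (positive⁻¹ 5ℚ)
  ; upper-inhabited = 5ℚ , positive⁻¹ 5ℚ , from-yes (5ℚ <? 5ℚ * 5ℚ)
  ; lower-closed    = closedˡ
  ; upper-closed    = λ { q<r (0<q , 5<q²) → <-trans 0<q q<r , <-trans 5<q² (square-mono (<⇒≤ 0<q) q<r) }
  ; lower-open      = openˡ
  ; upper-open      = openᵘ
  ; disjoint        = λ { (inj₁ q<0) (0<q , _) → <-asym q<0 0<q ; (inj₂ q²<5) (_ , 5<q²) → <-asym q²<5 5<q² }
  ; located         = λ {q} q<r → [ (λ l → inj₁ (closedˡ q<r l)) , inj₂ ]′ (√5-trichotomy _)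
  }
  where
  Lower Upper : ℚ → Set
  Lower q = q < 0ℚ ⊎ q * q < 5ℚ
  Upper q = 0ℚ < q × 5ℚ < q * q

  closedˡ : ∀ {q r} → q < r → Lower r → Lower q
  closedˡ q<r (inj₁ r<0) = inj₁ (<-trans q<r r<0)
  closedˡ {q} q<r (inj₂ r²<5) with q <? 0ℚ
  ... | yes q<0 = inj₁ q<0
  ... | no  q≮0 = inj₂ (<-trans (square-mono (≮⇒≥ q≮0) q<r) r²<5)

  openˡ : ∀ {q} → Lower q → ∃[ r ] q < r × Lower r
  openˡ {q} l with q <? 0ℚ | l
  ... | yes q<0 | _         = let r , q<r , r<0 = <-dense q<0 in r , q<r , inj₁ r<0
  ... | no  q≮0 | inj₁ q<0  = ⊥-elim (q≮0 q<0)
  ... | no  q≮0 | inj₂ q²<5 =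
      r , subst (q <_) r-lower (p<p+q (0<* 0<s 0<i))
        , inj₂ (subst (r * r <_) r²-lower (p<p+q (0<* (positive⁻¹ 20ℚ) (0<* 0<s (0<* 0<i 0<i)))))
    where
    open Step q (≮⇒≥ q≮0)
    0<s : 0ℚ < 5ℚ - q * q
    0<s = 0<q-p q²<5

  openᵘ : ∀ {q} → Upper q → ∃[ r ] r < q × Upper r
  openᵘ {q} (0<q , 5<q²) =
      r , subst (r <_) r-upper (p<p+q (0<* 0<s 0<i)) , 0<r
        , subst (5ℚ <_) r²-upper (p<p+q (0<* (positive⁻¹ 20ℚ) (0<* 0<s (0<* 0<i 0<i))))
    where
    open Step q (<⇒≤ 0<q)
    0<s : 0ℚ < q * q - 5ℚ
    0<s = 0<q-p 5<q²

√5-irrational : Irrational √5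
√5-irrational = √5-trichotomy

φ : ℝ
φ = ½ ·ᵣ (√5 +ᵣ 1ℚ)

φ-irrational : Irrational φ
φ-irrational = ·ᵣ-irrational ½ (√5 +ᵣ 1ℚ) (+ᵣ-irrational √5 1ℚ √5-irrational)

-- {(k+1) α}
fracMultiple : ∀ α → Irrational α → ℕ → ℝ
fracMultiple α irr k = fracPartᵣ (fromℤ (+ suc k) ·ᵣ α) (·ᵣ-irrational (fromℤ (+ suc k)) α irr)

-- i : Fin N stands for the number 1 + toℕ i of {1, …, N}.
IsKronecker : ∀ α → Irrational α → ∀ {N} → Permutation′ N → Set
IsKronecker α irr σ = ∀ i j → i Fin.< j →
  fracMultiple α irr (toℕ (σ ⟨$⟩ʳ i)) <ᵣ fracMultiple α irr (toℕ (σ ⟨$⟩ʳ j))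

-- F 0 = 0 is an auxiliary value.
F : ℕ → ℕ
F 0             = 0
F 1             = 1
F (suc (suc n)) = F (suc n) ℕ.+ F n

-- The cycles of the disjoint cycle decomposition are the orbits of σ. Each is
-- represented by any of its elements, so that counting cycles means counting
-- elements up to SameCycle.
module _ {N : ℕ} (σ : Permutation′ N) where

  SameCycle : Fin N → Fin N → Set
  SameCycle i j = ∃[ m ] fold i (σ ⟨$⟩ʳ_) m ≡ j

  -- The cycle (i, σ i, …, σ^(ℓ-1) i) through i has length ℓ.
  CycleLength : ℕ → Fin N → Set
  CycleLength ℓ i = 0 ℕ.< ℓ × fold i (σ ⟨$⟩ʳ_) ℓ ≡ i ×
    (∀ m → 0 ℕ.< m → m ℕ.< ℓ → fold i (σ ⟨$⟩ʳ_) m ≢ i)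

{-# OPTIONS --safe #-}
module Submission where

open import Defs
open import Data.Fin.Permutation using (Permutation′)
open import Data.Nat.Base using (ℕ; _>_; _%_)
open import Data.Product using (_×_; ∃!)
open import Data.Sum.Base using (_⊎_)
open import Relation.Binary.PropositionalEquality using (_≡_)

open import Data.Empty using (⊥-elim)
open import Data.Fin.Base as Fin using (Fin; toℕ)
open import Data.Fin.Induction using (<-weakInduction; >-weakInduction)
open import Data.Fin.Permutation using (_⟨$⟩ʳ_; _⟨$⟩ˡ_; inverseˡ)
import Data.Fin.Properties as Fin
open import Data.Integer.Base as ℤ using (ℤ; +_; -[1+_])
import Data.Integer.DivMod as ℤ
open import Data.Integer.Divisibility.Signed using (_∣_; divides; ∣-refl; ∣-trans; ∣⇒∣ᵤ; ∣m∣n⇒∣m+n; ∣m∣n⇒∣m-n; ∣n⇒∣m*n; ∣m⇒∣m*n)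
import Data.Integer.Properties as ℤ
import Data.Integer.Solver as ℤSolver
open import Data.Nat.Base as ℕ using (zero; suc)
import Data.Nat.Divisibility as ℕ
import Data.Nat.DivMod as ℕ
import Data.Nat.Properties as ℕ
import Data.Nat.Solver as ℕSolver
open import Data.Product using (∃-syntax; _,_; proj₁; proj₂)
open import Data.Rational.Literals using (fromℤ)
open import Data.Sum.Base using (inj₁; inj₂; [_,_]′)
open import Relation.Binary.Definitions using (tri<; tri≈; tri>)
open import Relation.Binary.PropositionalEquality using (_≢_; refl; sym; trans; cong; cong₂; subst; subst₂; module ≡-Reasoning)
open import Relation.Nullary using (¬_; yes; no)

-- With N = F n and b = F (n - 1), Cassini's identity reads b² + b N - N² = (-1)ⁿ.
-- It places N k φ, for 1 ≤ k ≤ N, strictly between k (N + b) and its neighbouring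
-- integer: the one above for odd n, the one below for even n. Hence each of the N
-- cells (t/N, (t+1)/N) contains exactly one point {k φ}, and k is determined by
-- k b ≡ t (n odd) or k b ≡ t + 1 (n even) modulo N. So σ is affine modulo N with
-- slope b⁻¹, where b² ≡ (-1)ⁿ. For even n, σ² = id. For odd n, numbering from 0,
-- σ² is the reflection i ↦ b - 1 - i, so σ⁴ = id, and the cycles of length at most
-- 2 come from the solutions of 2 i + 1 ≡ b: one if N is odd, two, swapped by σ,
-- if N is even.

open ℝ

-- Rational bounds on cuts, cells of fractional parts, and bounds on multiples of `φ`.

module CutBounds where
  open import Data.Rational.Base hiding (_/_)
  open import Data.Rational.Properties
  open import Data.Rational.Solver using (module +-*-Solver)
  import Data.Rational.Unnormalised.Base as ℚᵘ
  import Data.Rational.Unnormalised.Properties as ℚᵘ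

  fromℤ-homo-+ : ∀ a b → fromℤ (a ℤ.+ b) ≡ fromℤ a + fromℤ b
  fromℤ-homo-+ a b = toℚᵘ-injective (ℚᵘ.≃-trans
    (ℚᵘ.*≡* (cong (ℤ._* + 1) (sym (cong₂ ℤ._+_ (ℤ.*-identityʳ a) (ℤ.*-identityʳ b)))))
    (ℚᵘ.≃-sym (toℚᵘ-homo-+ (fromℤ a) (fromℤ b))))

  fromℤ-homo-* : ∀ a b → fromℤ (a ℤ.* b) ≡ fromℤ a * fromℤ b
  fromℤ-homo-* a b = toℚᵘ-injective (ℚᵘ.≃-sym (toℚᵘ-homo-* (fromℤ a) (fromℤ b)))

  fromℤ-homo-neg : ∀ a → fromℤ (ℤ.- a) ≡ - fromℤ a
  fromℤ-homo-neg a = toℚᵘ-injective (ℚᵘ.≃-sym (toℚᵘ-homo‿- (fromℤ a)))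

  fromℤ-homo-- : ∀ a b → fromℤ (a ℤ.- b) ≡ fromℤ a - fromℤ b
  fromℤ-homo-- a b = trans (fromℤ-homo-+ a (ℤ.- b)) (cong (λ z → fromℤ a + z) (fromℤ-homo-neg b))

  fromℤ-mono-< : ∀ {a b} → a ℤ.< b → fromℤ a < fromℤ b
  fromℤ-mono-< {a} {b} a<b = *<* (subst₂ ℤ._<_ (sym (ℤ.*-identityʳ a)) (sym (ℤ.*-identityʳ b)) a<b)

  fromℤ-cancel-< : ∀ {a b} → fromℤ a < fromℤ b → a ℤ.< b
  fromℤ-cancel-< {a} {b} (*<* a<b) = subst₂ ℤ._<_ (ℤ.*-identityʳ a) (ℤ.*-identityʳ b) a<b

  lower<upper : ∀ x {p q} → lower x p → upper x q → p < q
  lower<upper x {p} {q} l u with <-cmp p q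
  ... | tri< p<q _ _  = p<q
  ... | tri≈ _ refl _ = ⊥-elim (disjoint x l u)
  ... | tri> _ _ q<p  = ⊥-elim (disjoint x (lower-closed x q<p l) u)

  lower<upper-<ᵣ : ∀ x y {p q} → x <ᵣ y → lower x p → upper y q → p < q
  lower<upper-<ᵣ x y (r , u , l) lₓ uᵧ = <-trans (lower<upper x lₓ u) (lower<upper y {r} l uᵧ)

  ¬upper<upper : ∀ x {p q} → ¬ upper x p → upper x q → p < q
  ¬upper<upper x {p} {q} ¬u u with <-cmp p q
  ... | tri< p<q _ _  = p<q
  ... | tri≈ _ refl _ = ⊥-elim (¬u u)
  ... | tri> _ _ q<p  = ⊥-elim (¬u (upper-closed x q<p u))

  infixl 7 _/1+_

  _/1+_ : ℤ → ℕ → ℚ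
  z /1+ n = fromℤ z * 1/⁺ (fromℤ (+ suc n))

  /1+-cancel-< : ∀ {a b} n → a /1+ n < b /1+ n → a ℤ.< b
  /1+-cancel-< {a} {b} n h = fromℤ-cancel-< (subst₂ _<_
    (a/p*p (fromℤ a) (fromℤ (+ suc n))) (a/p*p (fromℤ b) (fromℤ (+ suc n)))
    (*-monoˡ-<-pos (fromℤ (+ suc n)) h))

  fromℤ≡/1+ : ∀ m n → fromℤ m ≡ (m ℤ.* + suc n) /1+ n
  fromℤ≡/1+ m n = sym (trans (cong (_* 1/⁺ (fromℤ (+ suc n))) (fromℤ-homo-* m (+ suc n)))
    (a*p/p (fromℤ m) (fromℤ (+ suc n))))

  -- The double negation is the form in which the cut of `x -ᵣ fromℤ m` evaluates the cut of `x`.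
  /1+-shift : ∀ a m n → (a ℤ.- m ℤ.* + suc n) /1+ n - (- fromℤ m) ≡ a /1+ n
  /1+-shift a m n = begin
    (a ℤ.- m ℤ.* d) /1+ n - (- fromℤ m)
      ≡⟨ cong (λ z → z * i - (- fromℤ m)) (fromℤ-homo-- a (m ℤ.* d)) ⟩
    (fromℤ a - fromℤ (m ℤ.* d)) * i - (- fromℤ m)
      ≡⟨ solve 4 (λ a b i m → (a :- b) :* i :- (:- m) := a :* i :+ (m :- b :* i)) refl
           (fromℤ a) (fromℤ (m ℤ.* d)) i (fromℤ m) ⟩
    a /1+ n + (fromℤ m - (m ℤ.* d) /1+ n)
      ≡⟨ cong (λ z → a /1+ n + (z - (m ℤ.* d) /1+ n)) (fromℤ≡/1+ m n) ⟩
    a /1+ n + ((m ℤ.* d) /1+ n - (m ℤ.* d) /1+ n)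
      ≡⟨ cong (λ z → a /1+ n + z) (+-inverseʳ ((m ℤ.* d) /1+ n)) ⟩
    a /1+ n + 0ℚ
      ≡⟨ +-identityʳ (a /1+ n) ⟩
    a /1+ n ∎
    where
    open ≡-Reasoning
    open +-*-Solver
    d = + suc n
    i = 1/⁺ (fromℤ d)

  -- Comparing `m ≤ x < m + 1` with the bounds on `x` gives `m * N < 1 + a` and `a < (m + 1) * N`
  -- for `N = suc n`, so `a - m * N` is a valid index in `Fin N`. The integer `m′` is hidden because
  -- only the residue of `a` matters later.
  fractional-cell : ∀ x m n a → IsFloor x m → lower x (a /1+ n) → upper x ((+ 1 ℤ.+ a) /1+ n) →
    ∃[ t ] (∃[ m′ ] + toℕ {suc n} t ≡ a ℤ.- m′ ℤ.* + suc n)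
      × lower (x -ᵣ fromℤ m) (+ toℕ t /1+ n) × upper (x -ᵣ fromℤ m) (+ suc (toℕ t) /1+ n)
  fractional-cell x m n a (¬um , um) l u = go (a ℤ.- m ℤ.* d) refl
    where
    open ℤSolver.+-*-Solver
    d = + suc n

    mN<1+a : m ℤ.* d ℤ.< + 1 ℤ.+ a
    mN<1+a = /1+-cancel-< n (¬upper<upper x (subst (λ z → ¬ upper x z) (fromℤ≡/1+ m n) ¬um) u)

    a<mN+N : a ℤ.< ℤ.suc m ℤ.* d
    a<mN+N = /1+-cancel-< n (lower<upper x l (subst (upper x) (fromℤ≡/1+ (ℤ.suc m) n) um))

    go : ∀ t → t ≡ a ℤ.- m ℤ.* d → ∃[ t ] (∃[ m′ ] + toℕ {suc n} t ≡ a ℤ.- m′ ℤ.* d)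
      × lower (x -ᵣ fromℤ m) (+ toℕ t /1+ n) × upper (x -ᵣ fromℤ m) (+ suc (toℕ t) /1+ n)
    -- A negative difference would make `1 + (a - m * N)` at most 0, against `m * N < 1 + a`.
    go -[1+ t ] eq = ⊥-elim (ℤ.≤⇒≯ (ℤ.0⊖m≤+ t) (subst (+ 0 ℤ.<_) (ℤ.[1+m]⊖[1+n]≡m⊖n 0 t) 0<1+t))
      where
      0<1+t : + 0 ℤ.< 1 ℤ.⊖ suc t
      0<1+t = subst₂ ℤ._<_ (ℤ.+-inverseʳ (m ℤ.* d))
        (trans (ℤ.+-assoc (+ 1) a _) (cong ℤ.suc (sym eq))) (ℤ.+-monoˡ-< (ℤ.- (m ℤ.* d)) mN<1+a)
    go (+ t) eq = Fin.fromℕ< t<N , (m , trans (cong +_ t≡) eq)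
      , subst (lower x) (sym (shift a (trans (cong +_ t≡) eq))) l
      , subst (upper x) (sym (shift (+ 1 ℤ.+ a) (trans (cong (λ z → + suc z) t≡) eq′))) u
      where
      t<N : t ℕ.< suc n
      t<N = ℤ.drop‿+<+ (subst₂ ℤ._<_ (sym eq)
        (solve 2 (λ m d → (con (+ 1) :+ m) :* d :- m :* d := d) refl m d) (ℤ.+-monoˡ-< (ℤ.- (m ℤ.* d)) a<mN+N))
      t≡ : toℕ (Fin.fromℕ< t<N) ≡ t
      t≡ = Fin.toℕ-fromℕ< t<N
      shift : ∀ {z} a → z ≡ a ℤ.- m ℤ.* d → z /1+ n - (- fromℤ m) ≡ a /1+ n
      shift a refl = /1+-shift a m n
      eq′ : + suc t ≡ (+ 1 ℤ.+ a) ℤ.- m ℤ.* d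
      eq′ = trans (cong ℤ.suc eq) (sym (ℤ.+-assoc (+ 1) a _))

  fracMultiple-cell : ∀ α irr k n a →
    lower (fromℤ (+ suc k) ·ᵣ α) (a /1+ n) → upper (fromℤ (+ suc k) ·ᵣ α) ((+ 1 ℤ.+ a) /1+ n) →
    ∃[ t ] (∃[ m′ ] + toℕ {suc n} t ≡ a ℤ.- m′ ℤ.* + suc n)
      × lower (fracMultiple α irr k) (+ toℕ t /1+ n) × upper (fracMultiple α irr k) (+ suc (toℕ t) /1+ n)
  fracMultiple-cell α irr k n a = fractional-cell kα (floorᵣ kα kα-irr) n a (proj₂ (floorOf kα kα-irr))
    where
    kα     = fromℤ (+ suc k) ·ᵣ α
    kα-irr = ·ᵣ-irrational (fromℤ (+ suc k)) α irr

  -- Completing the square: the cut of `φ` at `q` unfolds to the cut of `√5` at `q * 2 - 1`, because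
  -- dividing by `½` computes to multiplying by 2.
  [2q-1]² : ∀ q → fromℤ (+ 4) * (q * q - q - 1ℚ) + 5ℚ ≡ (q * fromℤ (+ 2) - 1ℚ) * (q * fromℤ (+ 2) - 1ℚ)
  [2q-1]² = solve 1 (λ q → con (fromℤ (+ 4)) :* (q :* q :- q :- con 1ℚ) :+ con 5ℚ :=
    (q :* con (fromℤ (+ 2)) :- con 1ℚ) :* (q :* con (fromℤ (+ 2)) :- con 1ℚ)) refl
    where open +-*-Solver

  0<*-cancelʳ : ∀ p {e} → 0ℚ < e → 0ℚ < p * e → 0ℚ < p
  0<*-cancelʳ p {e} 0<e h = *-cancelʳ-<-nonNeg e {{nonNegative (<⇒≤ 0<e)}} (subst (_< p * e) (sym (*-zeroˡ e)) h)

  *<0-cancelʳ : ∀ p {e} → 0ℚ < e → p * e < 0ℚ → p < 0ℚ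
  *<0-cancelʳ p {e} 0<e h = *-cancelʳ-<-nonNeg e {{nonNegative (<⇒≤ 0<e)}} (subst (p * e <_) (sym (*-zeroˡ e)) h)

  -- The factor `d` is a denominator to be cleared. The sign of `q * q - q - 1` alone cannot
  -- separate `q` above `φ` from `q` below the conjugate root; positivity of `2 q - 1` selects the
  -- right side. For `lower-φ` no such choice arises, since a square below 5 suffices.
  upper-φ : ∀ q {d} → 0ℚ < d → 0ℚ < (q + q - 1ℚ) * d → 0ℚ < (q * q - q - 1ℚ) * (d * d) → upper φ q
  upper-φ q {d} 0<d h₁ h₂ = subst (0ℚ <_) 2q-1 (0<*-cancelʳ (q + q - 1ℚ) 0<d h₁) ,
    subst₂ _<_ (+-identityˡ 5ℚ) ([2q-1]² q)
      (+-monoˡ-< 5ℚ (0<* (positive⁻¹ (fromℤ (+ 4))) (0<*-cancelʳ (q * q - q - 1ℚ) (0<* 0<d 0<d) h₂)))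
    where
    open +-*-Solver
    2q-1 : q + q - 1ℚ ≡ q * fromℤ (+ 2) - 1ℚ
    2q-1 = solve 1 (λ q → q :+ q :- con 1ℚ := q :* con (fromℤ (+ 2)) :- con 1ℚ) refl q

  lower-φ : ∀ q {d} → 0ℚ < d → (q * q - q - 1ℚ) * (d * d) < 0ℚ → lower φ q
  lower-φ q {d} 0<d h = inj₂ (subst₂ _<_ ([2q-1]² q) (+-identityˡ 5ℚ)
    (+-monoˡ-< 5ℚ (subst (fromℤ (+ 4) * (q * q - q - 1ℚ) <_) (*-zeroʳ (fromℤ (+ 4)))
      (*-monoʳ-<-pos (fromℤ (+ 4)) (*<0-cancelʳ (q * q - q - 1ℚ) (0<* 0<d 0<d) h)))))

  -- The norm of a - c φ in ℤ[φ]: for positive a and c it is negative iff a / c < φ.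
  Q : ℤ → ℤ → ℤ
  Q a c = a ℤ.* a ℤ.- a ℤ.* c ℤ.- c ℤ.* c

  module _ (k n : ℕ) (a : ℤ) where
    private
      K = + suc k
      N = + suc n
      c = K ℤ.* N
      -- The point at which the cut of `φ` is evaluated when the cut of `K · φ` is evaluated at
      -- `a / N`; it equals `a / c`.
      q = a /1+ n * 1/⁺ (fromℤ K)
      0<c : 0ℚ < fromℤ c
      0<c = fromℤ-mono-< {+ 0} {c} (ℤ.+<+ (ℕ.s≤s ℕ.z≤n))

      q*c : q * fromℤ c ≡ fromℤ a
      q*c = begin
        q * fromℤ c                  ≡⟨ cong (q *_) (fromℤ-homo-* K N) ⟩
        q * (fromℤ K * fromℤ N)      ≡⟨ *-assoc q (fromℤ K) (fromℤ N) ⟨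
        q * fromℤ K * fromℤ N        ≡⟨ cong (_* fromℤ N) (a/p*p (a /1+ n) (fromℤ K)) ⟩
        a /1+ n * fromℤ N            ≡⟨ a/p*p (fromℤ a) (fromℤ N) ⟩
        fromℤ a                      ∎
        where open ≡-Reasoning

      Q-homo : fromℤ (Q a c) ≡ (q * q - q - 1ℚ) * (fromℤ c * fromℤ c)
      Q-homo = begin
        fromℤ (Q a c)
          ≡⟨ fromℤ-homo-- (a ℤ.* a ℤ.- a ℤ.* c) (c ℤ.* c) ⟩
        fromℤ (a ℤ.* a ℤ.- a ℤ.* c) - fromℤ (c ℤ.* c)
          ≡⟨ cong₂ _-_ (fromℤ-homo-- (a ℤ.* a) (a ℤ.* c)) (fromℤ-homo-* c c) ⟩
        fromℤ (a ℤ.* a) - fromℤ (a ℤ.* c) - d * d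
          ≡⟨ cong₂ (λ y z → y - z - d * d) (fromℤ-homo-* a a) (fromℤ-homo-* a c) ⟩
        fromℤ a * fromℤ a - fromℤ a * d - d * d
          ≡⟨ cong (λ z → z * z - z * d - d * d) q*c ⟨
        (q * d) * (q * d) - q * d * d - d * d
          ≡⟨ solve 2 (λ q d → (q :* d) :* (q :* d) :- q :* d :* d :- d :* d
             := (q :* q :- q :- con 1ℚ) :* (d :* d)) refl q d ⟩
        (q * q - q - 1ℚ) * (d * d) ∎
        where
        open ≡-Reasoning
        open +-*-Solver
        d = fromℤ c

    upper-multiple-φ : c ℤ.< a ℤ.+ a → + 0 ℤ.< Q a c → upper (fromℤ K ·ᵣ φ) (a /1+ n)
    upper-multiple-φ h₁ h₂ = upper-φ q 0<c
      (subst (0ℚ <_) eq (0<q-p (fromℤ-mono-< h₁)))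
      (subst (0ℚ <_) Q-homo (fromℤ-mono-< h₂))
      where
      open +-*-Solver
      eq : fromℤ (a ℤ.+ a) - fromℤ c ≡ (q + q - 1ℚ) * fromℤ c
      eq = trans (cong (_- fromℤ c) (trans (fromℤ-homo-+ a a) (cong (λ z → z + z) (sym q*c))))
        (solve 2 (λ q d → q :* d :+ q :* d :- d := (q :+ q :- con 1ℚ) :* d) refl q (fromℤ c))

    lower-multiple-φ : Q a c ℤ.< + 0 → lower (fromℤ K ·ᵣ φ) (a /1+ n)
    lower-multiple-φ h = lower-φ q 0<c (subst (_< 0ℚ) Q-homo (fromℤ-mono-< h))

-- From the order of the points to residues modulo `N`.

open CutBounds
open import Data.Integer.Base using (_+_; _*_; _-_; -_; _<_; _≤_)
open ℤSolver using (module +-*-Solver)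

-- Upward induction gives `i ≤ f i`, downward induction `f i ≤ i`. It is applied to the map sending
-- a rank to the cell of the point of that rank.
strictMono⇒id : ∀ {N} (f : Fin N → Fin N) → (∀ {i j} → i Fin.< j → f i Fin.< f j) → ∀ i → f i ≡ i
strictMono⇒id {suc n} f mono i = Fin.≤-antisym (above i) (below i)
  where
  inject₁<suc : ∀ (j : Fin n) → Fin.inject₁ j Fin.< Fin.suc j
  inject₁<suc j = Fin.≤̄⇒inject₁< (ℕ.≤-refl {toℕ j})

  below : ∀ i → i Fin.≤ f i
  below = <-weakInduction (λ i → i Fin.≤ f i) ℕ.z≤n
    λ j j≤fj → ℕ.≤-trans
      (ℕ.s≤s (subst (ℕ._≤ toℕ (f (Fin.inject₁ j))) (Fin.toℕ-inject₁ j) j≤fj))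
      (mono (inject₁<suc j))

  above : ∀ i → f i Fin.≤ i
  above = >-weakInduction (λ i → f i Fin.≤ i) (Fin.≤fromℕ (f (Fin.fromℕ n)))
    λ j fj≤j → subst (toℕ (f (Fin.inject₁ j)) ℕ.≤_) (sym (Fin.toℕ-inject₁ j))
      (ℕ.s≤s⁻¹ (ℕ.≤-trans (mono (inject₁<suc j)) fj≤j))

-- The absolute difference is at most the larger of the two indices, hence below `N`, so a multiple
-- of `N` must be 0. This turns congruences into equalities throughout.
∣-difference⇒≡ : ∀ {N} (i j : Fin N) → + N ∣ + toℕ i - + toℕ j → i ≡ j
∣-difference⇒≡ {N} i j h with ℤ.∣ + toℕ i - + toℕ j ∣ in eq
... | zero  = Fin.toℕ-injective (ℤ.+-injective (ℤ.i-j≡0⇒i≡j (+ toℕ i) (+ toℕ j) (ℤ.∣i∣≡0⇒i≡0 eq)))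
... | suc d = ⊥-elim (ℕ.<⇒≱ d<N (ℕ.∣⇒≤ (subst (N ℕ.∣_) eq (∣⇒∣ᵤ h))))
  where
  d<N : suc d ℕ.< N
  d<N = ℕ.≤-<-trans
    (subst (ℕ._≤ toℕ i ℕ.⊔ toℕ j) (trans (cong ℤ.∣_∣ (sym (ℤ.m-n≡m⊖n (toℕ i) (toℕ j)))) eq)
      (ℤ.∣m⊝n∣≤m⊔n (toℕ i) (toℕ j)))
    (ℕ.⊔-pres-<m (Fin.toℕ<n i) (Fin.toℕ<n j))

-- If N k α lies in (a k, a k + 1) for integers a k that represent each residue
-- class modulo N once, the points {k α} lie in distinct cells (t/N, (t+1)/N),
-- so the i-th smallest of them lies in the i-th cell.
kronecker-residue : ∀ α irr {n} (σ : Permutation′ (suc n)) → IsKronecker α irr σ → (a : Fin (suc n) → ℤ) →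
  (∀ k → lower (fromℤ (+ suc (toℕ k)) ·ᵣ α) (a k /1+ n) × upper (fromℤ (+ suc (toℕ k)) ·ᵣ α) ((+ 1 + a k) /1+ n)) →
  (∀ k l → + suc n ∣ a k - a l → k ≡ l) →
  ∀ i → + suc n ∣ a (σ ⟨$⟩ʳ i) - + toℕ i
kronecker-residue α irr {n} σ kron a bounds a-injective i =
  subst (λ j → N ∣ a (σ ⟨$⟩ʳ i) - + toℕ j) (strictMono⇒id (λ j → t (σ ⟨$⟩ʳ j)) mono i) (t-residue (σ ⟨$⟩ʳ i))
  where
  open +-*-Solver
  N = + suc n

  cell : ∀ k → _
  cell k = fracMultiple-cell α irr (toℕ k) n (a k) (proj₁ (bounds k)) (proj₂ (bounds k))

  t : Fin (suc n) → Fin (suc n)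
  t k = proj₁ (cell k)

  t-residue : ∀ k → N ∣ a k - + toℕ (t k)
  t-residue k = let m , eq = proj₁ (proj₂ (cell k)) in
    divides m (trans (cong (λ z → a k - z) eq) (solve 2 (λ a b → a :- (a :- b) := b) refl (a k) (m * N)))

  t-injective : ∀ k l → t k ≡ t l → k ≡ l
  t-injective k l tk≡tl = a-injective k l (subst (N ∣_)
    (solve 3 (λ x y z → (x :- z) :- (y :- z) := x :- y) refl (a k) (a l) (+ toℕ (t l)))
    (∣m∣n⇒∣m-n (subst (λ j → N ∣ a k - + toℕ j) tk≡tl (t-residue k)) (t-residue l)))

  σ-injective : ∀ {i j} → σ ⟨$⟩ʳ i ≡ σ ⟨$⟩ʳ j → i ≡ j
  σ-injective eq = trans (sym (inverseˡ σ)) (trans (cong (σ ⟨$⟩ˡ_) eq) (inverseˡ σ))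

  mono : ∀ {i j} → i Fin.< j → t (σ ⟨$⟩ʳ i) Fin.< t (σ ⟨$⟩ʳ j)
  mono {i} {j} i<j =
    -- The order of two points only yields `t (σ i) < t (σ j) + 1`; equality of the cells is then
    -- excluded by injectivity.
    let _ , _ , l , _ = cell (σ ⟨$⟩ʳ i)
        _ , _ , _ , u = cell (σ ⟨$⟩ʳ j)
        ti<tj+1 = /1+-cancel-< n (lower<upper-<ᵣ (fracMultiple α irr (toℕ (σ ⟨$⟩ʳ i)))
          (fracMultiple α irr (toℕ (σ ⟨$⟩ʳ j))) (kron i j i<j) l u)
    in Fin.≤∧≢⇒< (ℕ.s≤s⁻¹ (ℤ.drop‿+<+ ti<tj+1))
         (λ eq → Fin.<⇒≢ i<j (σ-injective (t-injective _ _ eq)))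

-- Bounds on `k φ` from the norm, and the resulting congruences for the permutation.

0≤* : ∀ {x y} → + 0 ≤ x → + 0 ≤ y → + 0 ≤ x * y
0≤* {+ m} {+ n} _ _ = subst (+ 0 ≤_) (ℤ.pos-* m n) (ℤ.+≤+ ℕ.z≤n)

0≤+ : ∀ {x y} → + 0 ≤ x → + 0 ≤ y → + 0 ≤ x + y
0≤+ = ℤ.+-mono-≤

0≤⁺ : ∀ {n} → + 0 ≤ + n
0≤⁺ = ℤ.+≤+ ℕ.z≤n

0<1+ : ∀ {x} → + 0 ≤ x → + 0 < + 1 + x
0<1+ {+ _} _ = ℤ.+<+ (ℕ.s≤s ℕ.z≤n)

-- The norm of `b + N φ` in ℤ[φ]; it also equals `Q (N + b) N`.
fibNorm : ℕ → ℕ → ℤ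
fibNorm b N = + b * + b + + b * + N - + N * + N

-- b and n + 1 play the roles of two consecutive Fibonacci numbers.
module Arithmetic (b n : ℕ) where
  open +-*-Solver

  B = + b
  N = + suc n

  norm : ℤ
  norm = fibNorm b (suc n)

  P : ℤ
  P = N + B

  module _ (k : ℕ) (k≤n : suc k ℕ.≤ suc n) where
    private
      K = + suc k

      0≤N-K : + 0 ≤ N - K
      0≤N-K = ℤ.i≤j⇒0≤j-i (ℤ.+≤+ k≤n)

      0≤2KB : + 0 ≤ + 2 * (K * B)
      0≤2KB = 0≤* {+ 2} {K * B} 0≤⁺ (0≤* {K} {B} 0≤⁺ 0≤⁺)

      KN<2a : ∀ a {w} → + 0 ≤ w → a + a - K * N ≡ + 1 + w → K * N < a + a
      KN<2a a 0≤w eq = subst₂ _<_ (ℤ.+-identityˡ (K * N))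
        (solve 2 (λ x y → x :- y :+ y := x) refl (a + a) (K * N))
        (ℤ.+-monoˡ-< (K * N) (subst (+ 0 <_) (sym eq) (0<1+ 0≤w)))

    -- By homogeneity `Q (K * P) (K * N)` is `norm * K²`, here `- K²`. Raising the first argument by
    -- one adds `1 + K * N + 2 * K * B`, which exceeds `K²` because `K ≤ N`.
    kφ-bounds-odd : norm ≡ - (+ 1) →
      lower (fromℤ K ·ᵣ φ) (K * P /1+ n) × upper (fromℤ K ·ᵣ φ) ((+ 1 + K * P) /1+ n)
    kφ-bounds-odd norm≡-1 =
        lower-multiple-φ k n (K * P) (subst (_< + 0) (sym Q₁) ℤ.-<+)
      , upper-multiple-φ k n (+ 1 + K * P)
          (KN<2a (+ 1 + K * P) (0≤+ {+ 1} 0≤⁺ (0≤+ (0≤* {K} {N} 0≤⁺ 0≤⁺) 0≤2KB))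
            (solve 3 (λ K N B → (con (+ 1) :+ K :* (N :+ B)) :+ (con (+ 1) :+ K :* (N :+ B)) :- K :* N
               := con (+ 1) :+ (con (+ 1) :+ (K :* N :+ con (+ 2) :* (K :* B)))) refl K N B))
          (subst (+ 0 <_) (sym Q₂) (0<1+ (0≤+ (0≤* {K} 0≤⁺ 0≤N-K) 0≤2KB)))
      where
      Q₁ : Q (K * P) (K * N) ≡ - (K * K)
      Q₁ = trans (solve 3 (λ K N B →
          let a = K :* (N :+ B) ; c = K :* N in a :* a :- a :* c :- c :* c
            := (B :* B :+ B :* N :- N :* N) :* (K :* K)) refl K N B)
        (trans (cong (_* (K * K)) norm≡-1) (ℤ.-1*i≡-i (K * K)))
      Q₂ : Q (+ 1 + K * P) (K * N) ≡ + 1 + (K * (N - K) + + 2 * (K * B))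
      Q₂ = trans (solve 3 (λ K N B →
          let a = con (+ 1) :+ K :* (N :+ B) ; c = K :* N in a :* a :- a :* c :- c :* c
            := (B :* B :+ B :* N :- N :* N) :* (K :* K) :+ (con (+ 1) :+ (K :* N :+ con (+ 2) :* (K :* B)))) refl K N B)
        (trans (cong (λ z → z * (K * K) + (+ 1 + (K * N + + 2 * (K * B)))) norm≡-1)
          (solve 3 (λ K N B → con (- (+ 1)) :* (K :* K) :+ (con (+ 1) :+ (K :* N :+ con (+ 2) :* (K :* B)))
             := con (+ 1) :+ (K :* (N :- K) :+ con (+ 2) :* (K :* B))) refl K N B))

    -- Now `Q (K * P) (K * N)` is `K²`, so `K * P` is the upper numerator. Lowering it by one gives
    -- `K² - K * N - 2 * K * B + 1`, which is negative because `K ≤ N` and `B ≥ 1`.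
    kφ-bounds-even : norm ≡ + 1 → 0 ℕ.< b →
      lower (fromℤ K ·ᵣ φ) ((K * P - + 1) /1+ n) × upper (fromℤ K ·ᵣ φ) ((+ 1 + (K * P - + 1)) /1+ n)
    kφ-bounds-even norm≡1 0<b =
        lower-multiple-φ k n (K * P - + 1) (subst (_< + 0) (sym Q₁) (ℤ.neg-mono-< (0<1+
          (0≤+ (0≤* {K} 0≤⁺ 0≤N-K) (0≤* {+ 2} 0≤⁺ (0≤+ (0≤* {K} 0≤⁺ 0≤B-1) 0≤K-1))))))
      , upper-multiple-φ k n (+ 1 + (K * P - + 1))
          (KN<2a (+ 1 + (K * P - + 1)) (0≤+ (0≤+ 0≤K-1 (0≤* {K} {+ n} 0≤⁺ 0≤⁺)) 0≤2KB)
            (solve 3 (λ K n B →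
               let N = con (+ 1) :+ n ; a = con (+ 1) :+ (K :* (N :+ B) :- con (+ 1)) in a :+ a :- K :* N
               := con (+ 1) :+ (((K :- con (+ 1)) :+ K :* n) :+ con (+ 2) :* (K :* B))) refl K (+ n) B))
          (subst (+ 0 <_) (sym Q₂) (ℤ.+<+ (ℕ.s≤s ℕ.z≤n)))
      where
      0≤B-1 : + 0 ≤ B - + 1
      0≤B-1 = ℤ.i≤j⇒0≤j-i (ℤ.+≤+ 0<b)
      0≤K-1 : + 0 ≤ K - + 1
      0≤K-1 = ℤ.i≤j⇒0≤j-i {+ 1} {K} (ℤ.+≤+ (ℕ.s≤s ℕ.z≤n))
      Q₁ : Q (K * P - + 1) (K * N) ≡ - (+ 1 + (K * (N - K) + + 2 * (K * (B - + 1) + (K - + 1))))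
      Q₁ = trans (solve 3 (λ K N B →
          let a = K :* (N :+ B) :- con (+ 1) ; c = K :* N in a :* a :- a :* c :- c :* c
            := (B :* B :+ B :* N :- N :* N) :* (K :* K) :+ (con (+ 1) :- K :* N :- con (+ 2) :* (K :* B))) refl K N B)
        (trans (cong (λ z → z * (K * K) + (+ 1 - K * N - + 2 * (K * B))) norm≡1)
          (solve 3 (λ K N B → con (+ 1) :* (K :* K) :+ (con (+ 1) :- K :* N :- con (+ 2) :* (K :* B))
             := :- (con (+ 1) :+ (K :* (N :- K) :+ con (+ 2) :* (K :* (B :- con (+ 1)) :+ (K :- con (+ 1))))))
             refl K N B))
      Q₂ : Q (+ 1 + (K * P - + 1)) (K * N) ≡ K * K
      Q₂ = trans (solve 3 (λ K N B →
          let a = con (+ 1) :+ (K :* (N :+ B) :- con (+ 1)) ; c = K :* N in a :* a :- a :* c :- c :* c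
            := (B :* B :+ B :* N :- N :* N) :* (K :* K)) refl K N B)
        (trans (cong (_* (K * K)) norm≡1) (ℤ.*-identityˡ (K * K)))

  N∣b²-norm : N ∣ B * B - norm
  N∣b²-norm = divides (N - B)
    (solve 2 (λ B N → B :* B :- (B :* B :+ B :* N :- N :* N) := (N :- B) :* N) refl B N)

  N∣x*P⇒N∣x*B : ∀ x y → N ∣ x * P - y → N ∣ x * B - y
  N∣x*P⇒N∣x*B x y h = subst (N ∣_)
    (solve 4 (λ x y B N → (x :* (N :+ B) :- y) :- x :* N := x :* B :- y) refl x y B N)
    (∣m∣n⇒∣m-n h (∣n⇒∣m*n x ∣-refl))

  -- Modulo `N`, `P` is `B` and `B²` is `norm`; as `norm² = 1`, the inverse of `P` is `norm * B`.
  -- Hence distinct `k` have numerators in distinct residue classes.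
  P-cancel : norm * norm ≡ + 1 → ∀ x → N ∣ x * P → N ∣ x
  P-cancel norm² x h = subst (N ∣_)
    (trans (solve 4 (λ x B s N → s :* ((B :- N) :* (x :* (N :+ B)) :+ x :* N :* N :- x :* (B :* B :- s))
        := s :* s :* x) refl x B norm N)
      (trans (cong (_* x) norm²) (ℤ.*-identityˡ x)))
    (∣n⇒∣m*n norm (∣m∣n⇒∣m-n
      (∣m∣n⇒∣m+n (∣n⇒∣m*n (B - N) h) (∣n⇒∣m*n (x * N) ∣-refl)) (∣n⇒∣m*n x N∣b²-norm)))

  module _ (σ : Permutation′ (suc n)) (kron : IsKronecker φ φ-irrational σ) where

    kronecker-φ-odd : norm ≡ - (+ 1) → ∀ i → N ∣ + suc (toℕ (σ ⟨$⟩ʳ i)) * B - + toℕ i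
    kronecker-φ-odd norm≡-1 i = N∣x*P⇒N∣x*B (+ suc (toℕ (σ ⟨$⟩ʳ i))) (+ toℕ i)
      (kronecker-residue φ φ-irrational σ kron (λ k → + suc (toℕ k) * P)
        (λ k → kφ-bounds-odd (toℕ k) (Fin.toℕ<n k) norm≡-1)
        (λ k l h → ∣-difference⇒≡ k l (P-cancel (cong (λ z → z * z) norm≡-1) (+ toℕ k - + toℕ l)
          (subst (N ∣_) (solve 3 (λ k l P → (con (+ 1) :+ k) :* P :- (con (+ 1) :+ l) :* P := (k :- l) :* P) refl
            (+ toℕ k) (+ toℕ l) P) h)))
        i)

    -- The numerator `K * P - 1` shifts the cell index by one, so labels counted from 1 appear on
    -- both sides and the relation is linear modulo `N`; in the odd case it is only affine.
    kronecker-φ-even : norm ≡ + 1 → 0 ℕ.< b → ∀ i → N ∣ + suc (toℕ (σ ⟨$⟩ʳ i)) * B - + suc (toℕ i)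
    kronecker-φ-even norm≡1 0<b i = N∣x*P⇒N∣x*B (+ suc (toℕ (σ ⟨$⟩ʳ i))) (+ suc (toℕ i)) (subst (N ∣_)
      (solve 2 (λ x y → x :- con (+ 1) :- y := x :- (con (+ 1) :+ y)) refl (+ suc (toℕ (σ ⟨$⟩ʳ i)) * P) (+ toℕ i))
      (kronecker-residue φ φ-irrational σ kron (λ k → + suc (toℕ k) * P - + 1)
        (λ k → kφ-bounds-even (toℕ k) (Fin.toℕ<n k) norm≡1 0<b)
        (λ k l h → ∣-difference⇒≡ k l (P-cancel (cong (λ z → z * z) norm≡1) (+ toℕ k - + toℕ l)
          (subst (N ∣_) (solve 3 (λ k l P → ((con (+ 1) :+ k) :* P :- con (+ 1)) :- ((con (+ 1) :+ l) :* P :- con (+ 1))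
            := (k :- l) :* P) refl (+ toℕ k) (+ toℕ l) P) h)))
        i))

-- Cycle lengths from iterates.

module _ {N : ℕ} (σ : Permutation′ N) where
  private
    s = σ ⟨$⟩ʳ_

  cycleLength-1 : ∀ {i} → s i ≡ i → CycleLength σ 1 i
  cycleLength-1 si≡i = ℕ.s≤s ℕ.z≤n , si≡i , λ { (suc m) _ (ℕ.s≤s ()) }

  cycleLength-2 : ∀ {i} → s i ≢ i → s (s i) ≡ i → CycleLength σ 2 i
  cycleLength-2 si≢i s²i≡i = ℕ.s≤s ℕ.z≤n , s²i≡i ,
    λ { 1 _ _ → si≢i ; (suc (suc m)) _ (ℕ.s≤s (ℕ.s≤s ())) }

  -- Returning after 1 step implies returning after 2, and returning after both 3 and 4 steps
  -- implies returning after 1.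
  cycleLength-4 : ∀ {i} → s (s i) ≢ i → s (s (s (s i))) ≡ i → CycleLength σ 4 i
  cycleLength-4 {i} s²i≢i s⁴i≡i = ℕ.s≤s ℕ.z≤n , s⁴i≡i , λ
    { 1 _ _ si≡i → s²i≢i (trans (cong s si≡i) si≡i)
    ; 2 _ _ → s²i≢i
    ; 3 _ _ s³i≡i → let i≡si = trans (sym s⁴i≡i) (cong s s³i≡i) in
        s²i≢i (trans (cong s (sym i≡si)) (sym i≡si))
    ; (suc (suc (suc (suc m)))) _ (ℕ.s≤s (ℕ.s≤s (ℕ.s≤s (ℕ.s≤s ())))) }

-- Parity and division by 2 modulo `N`.

Even Odd : ℕ → Set
Even n = ∃[ h ] n ≡ 2 ℕ.* h
Odd  n = ∃[ h ] n ≡ 1 ℕ.+ 2 ℕ.* h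

even⊎odd : ∀ n → Even n ⊎ Odd n
even⊎odd zero = inj₁ (0 , refl)
even⊎odd (suc n) with even⊎odd n
... | inj₁ (h , eq) = inj₂ (h , cong suc eq)
... | inj₂ (h , eq) = inj₁ (suc h , trans (cong suc eq) (sym (ℕ.*-suc 2 h)))

even⇒2∣ : ∀ {n} → Even n → + 2 ∣ + n
even⇒2∣ (h , eq) = divides (+ h) (trans (cong +_ (trans eq (ℕ.*-comm 2 h))) (ℤ.pos-* h 2))

odd⇒2∣-1 : ∀ {n} → Odd n → + 2 ∣ + n - + 1
odd⇒2∣-1 (h , refl) = even⇒2∣ (h , refl)

2∤1 : ¬ (+ 2 ∣ + 1)
2∤1 h with () ← ℕ.∣1⇒≡1 (∣⇒∣ᵤ h)

ℤ-even⊎odd : ∀ q → (∃[ h ] q ≡ h * + 2) ⊎ (∃[ h ] q ≡ + 1 + h * + 2)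
ℤ-even⊎odd q with q ℤ.% + 2 | ℤ.n%d<d q (+ 2) | ℤ.a≡a%n+[a/n]*n q (+ 2)
... | 0 | _ | eq = inj₁ (q ℤ./ + 2 , trans eq (ℤ.+-identityˡ _))
... | 1 | _ | eq = inj₂ (q ℤ./ + 2 , eq)
... | suc (suc _) | ℕ.s≤s (ℕ.s≤s ()) | _

-- Writing `n = 1 + 2 g` gives `x = n x - g (2 x)`.
odd-cancel-2 : ∀ {n} → Odd n → ∀ x → + n ∣ + 2 * x → + n ∣ x
odd-cancel-2 {n} odd x n∣2x with divides g eq ← odd⇒2∣-1 odd = subst (+ n ∣_)
  (trans (cong (λ z → x * z - g * (+ 2 * x)) n≡)
    (solve 2 (λ x g → x :* (con (+ 1) :+ g :* con (+ 2)) :- g :* (con (+ 2) :* x) := x) refl x g))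
  (∣m∣n⇒∣m-n (∣n⇒∣m*n x ∣-refl) (∣n⇒∣m*n g n∣2x))
  where
  open +-*-Solver
  n≡ : + n ≡ + 1 + g * + 2
  n≡ = trans (solve 1 (λ n → n := con (+ 1) :+ (n :- con (+ 1))) refl (+ n)) (cong (λ z → + 1 + z) eq)

-- Modulo N there is at most one x ≢ 0 with 2 x ≡ 0.
∣2x∣2y-cases : ∀ {N x y} → N ∣ + 2 * x → N ∣ + 2 * y → N ∣ x ⊎ N ∣ y ⊎ N ∣ x - y
∣2x∣2y-cases {N} {x} {y} (divides p ep) (divides q eq) with ℤ-even⊎odd p | ℤ-even⊎odd q
... | inj₁ (h , refl) | _ = inj₁ (divides h (ℤ.*-cancelˡ-≡ (+ 2) x (h * N)
      (trans ep (solve 2 (λ h N → h :* con (+ 2) :* N := con (+ 2) :* (h :* N)) refl h N))))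
  where open +-*-Solver
... | inj₂ _ | inj₁ (h , refl) = inj₂ (inj₁ (divides h (ℤ.*-cancelˡ-≡ (+ 2) y (h * N)
      (trans eq (solve 2 (λ h N → h :* con (+ 2) :* N := con (+ 2) :* (h :* N)) refl h N)))))
  where open +-*-Solver
-- Both multipliers are odd, so their difference is even and the factor 2 cancels.
... | inj₂ (g , refl) | inj₂ (h , refl) = inj₂ (inj₂ (divides (g - h) (ℤ.*-cancelˡ-≡ (+ 2) (x - y) ((g - h) * N)
      (trans (solve 2 (λ x y → con (+ 2) :* (x :- y) := con (+ 2) :* x :- con (+ 2) :* y) refl x y)
        (trans (cong₂ _-_ ep eq)
          (solve 3 (λ g h N → (con (+ 1) :+ g :* con (+ 2)) :* N :- (con (+ 1) :+ h :* con (+ 2)) :* N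
            := con (+ 2) :* ((g :- h) :* N)) refl g h N))))))
  where open +-*-Solver

-- Cycles of permutations that are affine modulo `N`.

module _ {N : ℕ} (b : ℕ) where
  open +-*-Solver
  private B = + b

  -- For odd n these i turn out to be the fixed points of σ².
  Half : Fin N → Set
  Half i = + N ∣ + 1 + + 2 * + toℕ i - B

  half-difference : ∀ i j → Half i → Half j → + N ∣ + 2 * (+ toℕ i - + toℕ j)
  half-difference i j hi hj = subst (+ N ∣_)
    (solve 3 (λ i j B → (con (+ 1) :+ con (+ 2) :* i :- B) :- (con (+ 1) :+ con (+ 2) :* j :- B)
      := con (+ 2) :* (i :- j)) refl (+ toℕ i) (+ toℕ j) B)
    (∣m∣n⇒∣m-n hi hj)

  -- For odd `b` the witness solves `1 + 2 i = b`; for even `b` and odd `N` it solves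
  -- `1 + 2 i = b + N`. In both cases `b ≤ N` keeps `i` below `N`.
  half-exists : b ℕ.≤ N → Odd b ⊎ Odd N → ∃[ i ] Half i
  half-exists b≤N parity with even⊎odd b | parity
  ... | inj₂ (h , refl) | _ = Fin.fromℕ< h<N , divides (+ 0)
      (trans (cong₂ (λ y z → + 1 + + 2 * + y - (+ 1 + z)) (Fin.toℕ-fromℕ< h<N) (ℤ.pos-* 2 h))
        (solve 1 (λ h → con (+ 1) :+ con (+ 2) :* h :- (con (+ 1) :+ con (+ 2) :* h) := con (+ 0)) refl (+ h)))
    where
    h<N : h ℕ.< N
    h<N = ℕ.≤-trans (ℕ.s≤s (ℕ.m≤m+n h (h ℕ.+ 0))) b≤N
  ... | inj₁ (h , refl) | inj₁ (g , eq) = ⊥-elim (ℕ.even≢odd h g eq)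
  ... | inj₁ (h , refl) | inj₂ (g , refl) = Fin.fromℕ< h+g<N , divides (+ 1)
      (trans (cong₂ (λ y z → + 1 + + 2 * y - z) (cong +_ (Fin.toℕ-fromℕ< h+g<N)) (ℤ.pos-* 2 h))
        (trans (solve 2 (λ h g → con (+ 1) :+ con (+ 2) :* (h :+ g) :- con (+ 2) :* h
            := con (+ 1) :* (con (+ 1) :+ con (+ 2) :* g)) refl (+ h) (+ g))
          (cong (λ z → + 1 * (+ 1 + z)) (sym (ℤ.pos-* 2 g)))))
    where
    h≤g : h ℕ.≤ g
    h≤g = ℕ.s≤s⁻¹ (ℕ.*-cancelˡ-< 2 h (suc g) (subst (2 ℕ.* h ℕ.<_) (sym (ℕ.*-suc 2 g)) (ℕ.s≤s b≤N)))
    h+g<N : h ℕ.+ g ℕ.< 1 ℕ.+ 2 ℕ.* g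
    h+g<N = ℕ.s≤s (ℕ.+-mono-≤ h≤g (ℕ.m≤m+n g 0))

  module _ (σ : Permutation′ N) where
    private
      s = σ ⟨$⟩ʳ_
      ι : Fin N → ℤ
      ι i = + toℕ i

    module _ (b²≡1 : + N ∣ B * B - + 1) (residue : ∀ i → + N ∣ (+ 1 + ι (s i)) * B - (+ 1 + ι i)) where

      -- On labels counted from 1, `s` inverts multiplication by `B`, and `B² ≡ 1`.
      s²-even : ∀ i → s (s i) ≡ i
      s²-even i = ∣-difference⇒≡ (s (s i)) i (subst (+ N ∣_)
        (solve 4 (λ x y z B →
          let x′ = con (+ 1) :+ x ; y′ = con (+ 1) :+ y ; z′ = con (+ 1) :+ z in
          (z′ :* B :- y′) :* B :+ (y′ :* B :- x′) :- z′ :* (B :* B :- con (+ 1))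
            := z :- x) refl (ι i) (ι (s i)) (ι (s (s i))) B)
        (∣m∣n⇒∣m-n (∣m∣n⇒∣m+n (∣m⇒∣m*n B (residue (s i))) (residue i)) (∣n⇒∣m*n (+ 1 + ι (s (s i))) b²≡1)))

      cycles-even : ∀ i → CycleLength σ 2 i ⊎ CycleLength σ 1 i
      cycles-even i with s i Fin.≟ i
      ... | yes si≡i = inj₂ (cycleLength-1 σ si≡i)
      ... | no  si≢i = inj₁ (cycleLength-2 σ si≢i (s²-even i))

    module _ (b²≡-1 : + N ∣ B * B - - (+ 1)) (residue : ∀ i → + N ∣ (+ 1 + ι (s i)) * B - ι i) where

      -- With `x`, `y`, `z` the values of `i`, `s i`, `s (s i)`, the residues give
      -- `(1 + z) B² ≡ y B ≡ x - B`; now insert `B² ≡ -1`. This is a reflection, so applying it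
      -- twice gives `s⁴-odd`.
      s²-odd : ∀ i → + N ∣ + 1 + ι (s (s i)) + ι i - B
      s²-odd i = subst (+ N ∣_)
        (solve 4 (λ x y z B →
          (con (+ 1) :+ z) :* (B :* B :- con (- (+ 1))) :- B :* ((con (+ 1) :+ z) :* B :- y)
            :- ((con (+ 1) :+ y) :* B :- x)
            := con (+ 1) :+ z :+ x :- B) refl (ι i) (ι (s i)) (ι (s (s i))) B)
        (∣m∣n⇒∣m-n (∣m∣n⇒∣m-n (∣n⇒∣m*n (+ 1 + ι (s (s i))) b²≡-1) (∣n⇒∣m*n B (residue (s i)))) (residue i))

      s⁴-odd : ∀ i → s (s (s (s i))) ≡ i
      s⁴-odd i = ∣-difference⇒≡ (s (s (s (s i)))) i (subst (+ N ∣_)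
        (solve 4 (λ x y z B → (con (+ 1) :+ z :+ y :- B) :- (con (+ 1) :+ y :+ x :- B) := z :- x)
          refl (ι i) (ι (s (s i))) (ι (s (s (s (s i))))) B)
        (∣m∣n⇒∣m-n (s²-odd (s (s i))) (s²-odd i)))

      s²i≡i⇒half : ∀ {i} → s (s i) ≡ i → Half i
      s²i≡i⇒half {i} eq = subst (+ N ∣_)
        (trans (cong (λ j → + 1 + ι j + ι i - B) eq)
          (solve 2 (λ x B → con (+ 1) :+ x :+ x :- B := con (+ 1) :+ con (+ 2) :* x :- B) refl (ι i) B))
        (s²-odd i)

      half⇒s²i≡i : ∀ {i} → Half i → s (s i) ≡ i
      half⇒s²i≡i {i} hi = ∣-difference⇒≡ (s (s i)) i (subst (+ N ∣_)
        (solve 3 (λ x z B → (con (+ 1) :+ z :+ x :- B) :- (con (+ 1) :+ con (+ 2) :* x :- B)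
          := z :- x) refl (ι i) (ι (s (s i))) B)
        (∣m∣n⇒∣m-n (s²-odd i) hi))

      half-s : ∀ {i} → Half i → Half (s i)
      half-s hi = s²i≡i⇒half (cong s (half⇒s²i≡i hi))

      module _ (b≤N : b ℕ.≤ N) (N-odd : Odd N) where

        half-unique : ∀ {i j} → Half i → Half j → i ≡ j
        half-unique {i} {j} hi hj = ∣-difference⇒≡ i j (odd-cancel-2 N-odd _ (half-difference i j hi hj))

        -- The image under `s` of the unique `Half` element is again `Half`, so that element is
        -- fixed. No other element is fixed even by the square of `s`, which rules out 2-cycles.
        cycles-4-1 : (∀ i → CycleLength σ 4 i ⊎ CycleLength σ 1 i) × ∃! (SameCycle σ) (CycleLength σ 1)
        cycles-4-1 = lengths , i₀ , cycleLength-1 σ (half-unique (half-s half-i₀) half-i₀) ,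
            λ { (_ , sy≡y , _) → 0 , half-unique half-i₀ (s²i≡i⇒half (trans (cong s sy≡y) sy≡y)) }
          where
          i₀      = proj₁ (half-exists b≤N (inj₂ N-odd))
          half-i₀ = proj₂ (half-exists b≤N (inj₂ N-odd))

          lengths : ∀ i → CycleLength σ 4 i ⊎ CycleLength σ 1 i
          lengths i with s (s i) Fin.≟ i
          ... | yes s²i≡i = let hi = s²i≡i⇒half s²i≡i in inj₂ (cycleLength-1 σ (half-unique (half-s hi) hi))
          ... | no  s²i≢i = inj₁ (cycleLength-4 σ s²i≢i (s⁴-odd i))

      module _ (b≤N : b ℕ.≤ N) (N-even : Even N) (b-odd : Odd b) where

        -- Since `N` is even and `b` odd, a fixed point `x` would satisfy `1 + x ≡ x` modulo 2.
        s-no-fixed-point : ∀ i → s i ≢ i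
        s-no-fixed-point i si≡i = 2∤1 (subst (+ 2 ∣_)
          (solve 2 (λ x B → (con (+ 1) :+ x) :* B :- x :- (con (+ 1) :+ x) :* (B :- con (+ 1)) := con (+ 1))
            refl (ι i) B)
          (∣m∣n⇒∣m-n
            (∣-trans (even⇒2∣ N-even) (subst (λ j → + N ∣ (+ 1 + ι j) * B - ι i) si≡i (residue i)))
            (∣n⇒∣m*n (+ 1 + ι i) (odd⇒2∣-1 b-odd))))

        -- Both `i - j` and `i - s i` are killed by 2 modulo `N`, and the latter is nonzero, so
        -- `i - j` is either 0 or equal to it.
        half-cases : ∀ {i j} → Half i → Half j → i ≡ j ⊎ s i ≡ j
        half-cases {i} {j} hi hj =
          cases (∣2x∣2y-cases {+ N} {ι i - ι j} {ι i - ι (s i)}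
            (half-difference i j hi hj) (half-difference i (s i) hi (half-s hi)))
          where
          cases : + N ∣ ι i - ι j ⊎ + N ∣ ι i - ι (s i) ⊎ + N ∣ (ι i - ι j) - (ι i - ι (s i)) → i ≡ j ⊎ s i ≡ j
          cases (inj₁ h)        = inj₁ (∣-difference⇒≡ i j h)
          cases (inj₂ (inj₁ h)) = ⊥-elim (s-no-fixed-point i (sym (∣-difference⇒≡ i (s i) h)))
          cases (inj₂ (inj₂ h)) = inj₂ (∣-difference⇒≡ (s i) j (subst (+ N ∣_)
            (solve 3 (λ x y z → (x :- y) :- (x :- z) := z :- y) refl (ι i) (ι j) (ι (s i))) h))

        cycles-4-2 : (∀ i → CycleLength σ 4 i ⊎ CycleLength σ 2 i) × ∃! (SameCycle σ) (CycleLength σ 2)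
        cycles-4-2 = lengths , i₀ , cycleLength-2 σ (s-no-fixed-point i₀) (half⇒s²i≡i half-i₀) , same
          where
          i₀      = proj₁ (half-exists b≤N (inj₁ b-odd))
          half-i₀ = proj₂ (half-exists b≤N (inj₁ b-odd))

          same : ∀ {j} → CycleLength σ 2 j → SameCycle σ i₀ j
          same (_ , s²j≡j , _) =
            [ (λ i₀≡j → 0 , i₀≡j) , (λ si₀≡j → 1 , si₀≡j) ]′ (half-cases half-i₀ (s²i≡i⇒half s²j≡j))

          lengths : ∀ i → CycleLength σ 4 i ⊎ CycleLength σ 2 i
          lengths i with s (s i) Fin.≟ i
          ... | yes s²i≡i = inj₂ (cycleLength-2 σ (s-no-fixed-point i) s²i≡i)
          ... | no  s²i≢i = inj₁ (cycleLength-4 σ s²i≢i (s⁴-odd i))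

-- Cassini's identity and the parity of Fibonacci numbers.

-- Multiplication by `φ`, a unit of norm -1, sends `b + N φ` to `N + (N + b) φ`.
fibNorm-step : ∀ b N → fibNorm N (N ℕ.+ b) ≡ - fibNorm b N
fibNorm-step b N = solve 2 (λ b N → N :* N :+ N :* (N :+ b) :- (N :+ b) :* (N :+ b)
  := :- (b :* b :+ b :* N :- N :* N)) refl (+ b) (+ N)
  where open +-*-Solver

cassini-odd : ∀ q → fibNorm (F (q ℕ.* 2)) (F (1 ℕ.+ q ℕ.* 2)) ≡ - (+ 1)
cassini-even : ∀ q → fibNorm (F (1 ℕ.+ q ℕ.* 2)) (F (2 ℕ.+ q ℕ.* 2)) ≡ + 1

cassini-odd zero    = refl
cassini-odd (suc q) = trans (fibNorm-step (F (1 ℕ.+ q ℕ.* 2)) (F (2 ℕ.+ q ℕ.* 2))) (cong -_ (cassini-even q))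

cassini-even q = trans (fibNorm-step (F (q ℕ.* 2)) (F (1 ℕ.+ q ℕ.* 2))) (cong -_ (cassini-odd q))

0<F : ∀ n → 0 ℕ.< F (suc n)
0<F zero    = ℕ.s≤s ℕ.z≤n
0<F (suc n) = ℕ.<-≤-trans (0<F n) (ℕ.m≤m+n (F (suc n)) (F n))

F≤F-suc : ∀ n → F n ℕ.≤ F (suc n)
F≤F-suc zero    = ℕ.z≤n
F≤F-suc (suc n) = ℕ.m≤m+n (F (suc n)) (F n)

-- This is `8 F (n + 1) + 5 F n`, split to show that parity depends only on the index modulo 6.
F-6+ : ∀ n → F (6 ℕ.+ n) ≡ F n ℕ.+ 2 ℕ.* (4 ℕ.* F (suc n) ℕ.+ 2 ℕ.* F n)
F-6+ n = solve 2 (λ x y →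
  let F₂ = x :+ y ; F₃ = F₂ :+ x ; F₄ = F₃ :+ F₂ ; F₅ = F₄ :+ F₃ in
  F₅ :+ F₄ := y :+ con 2 :* (con 4 :* x :+ con 2 :* y)) refl (F (suc n)) (F n)
  where open ℕSolver.+-*-Solver

F-odd-periodic : ∀ q {r} → Odd (F r) → Odd (F (q ℕ.* 6 ℕ.+ r))
F-odd-periodic zero    odd = odd
F-odd-periodic (suc q) {r} odd =
  let n = q ℕ.* 6 ℕ.+ r
      w = 4 ℕ.* F (suc n) ℕ.+ 2 ℕ.* F n
      h , eq = F-odd-periodic q odd
  in h ℕ.+ w , trans (F-6+ n) (trans (cong (ℕ._+ 2 ℕ.* w) eq) (cong suc (sym (ℕ.*-distribˡ-+ 2 h w))))

F-even-periodic : ∀ q {r} → Even (F r) → Even (F (q ℕ.* 6 ℕ.+ r))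
F-even-periodic zero    even = even
F-even-periodic (suc q) {r} even =
  let n = q ℕ.* 6 ℕ.+ r
      w = 4 ℕ.* F (suc n) ℕ.+ 2 ℕ.* F n
      h , eq = F-even-periodic q even
  in h ℕ.+ w , trans (F-6+ n) (trans (cong (ℕ._+ 2 ℕ.* w) eq) (sym (ℕ.*-distribˡ-+ 2 h w)))

-- Two even arguments would make the norm even.
fibNorm≡-1⇒odd : ∀ b N → fibNorm b N ≡ - (+ 1) → Even N → Odd b
fibNorm≡-1⇒odd b N norm≡-1 N-even with even⊎odd b
... | inj₂ b-odd  = b-odd
... | inj₁ b-even = ⊥-elim (2∤1 (subst (λ z → + 2 ∣ - z) norm≡-1 (subst (+ 2 ∣_)
  (solve 2 (λ b N → N :* N :- (b :+ N) :* b := :- (b :* b :+ b :* N :- N :* N)) refl (+ b) (+ N))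
  (∣m∣n⇒∣m-n (∣n⇒∣m*n (+ N) (even⇒2∣ N-even)) (∣n⇒∣m*n (+ b + + N) (even⇒2∣ b-even))))))
  where open +-*-Solver

-- Assembly for Fibonacci numbers.

-- Here and in the two odd cases `N` is a variable so that it can be matched as `suc n`; `F (suc m)`
-- does not reduce to a successor.
kronecker-even : ∀ b N → 0 ℕ.< N → (σ : Permutation′ N) → IsKronecker φ φ-irrational σ →
  fibNorm b N ≡ + 1 → 0 ℕ.< b → ∀ i → CycleLength σ 2 i ⊎ CycleLength σ 1 i
kronecker-even b (suc n) _ σ kron norm≡1 0<b = cycles-even b σ
  (subst (λ z → + suc n ∣ + b * + b - z) norm≡1 (N∣b²-norm b n))
  (kronecker-φ-even b n σ kron norm≡1 0<b)
  where open Arithmetic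

kronecker-odd-N-odd : ∀ b N → 0 ℕ.< N → (σ : Permutation′ N) → IsKronecker φ φ-irrational σ →
  fibNorm b N ≡ - (+ 1) → b ℕ.≤ N → Odd N →
  (∀ i → CycleLength σ 4 i ⊎ CycleLength σ 1 i) × ∃! (SameCycle σ) (CycleLength σ 1)
kronecker-odd-N-odd b (suc n) _ σ kron norm≡-1 = cycles-4-1 b σ
  (subst (λ z → + suc n ∣ + b * + b - z) norm≡-1 (N∣b²-norm b n))
  (kronecker-φ-odd b n σ kron norm≡-1)
  where open Arithmetic

kronecker-odd-N-even : ∀ b N → 0 ℕ.< N → (σ : Permutation′ N) → IsKronecker φ φ-irrational σ →
  fibNorm b N ≡ - (+ 1) → b ℕ.≤ N → Even N →
  (∀ i → CycleLength σ 4 i ⊎ CycleLength σ 2 i) × ∃! (SameCycle σ) (CycleLength σ 2)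
kronecker-odd-N-even b (suc n) _ σ kron norm≡-1 b≤N N-even = cycles-4-2 b σ
  (subst (λ z → + suc n ∣ + b * + b - z) norm≡-1 (N∣b²-norm b n))
  (kronecker-φ-odd b n σ kron norm≡-1)
  b≤N N-even (fibNorm≡-1⇒odd b (suc n) norm≡-1 N-even)
  where open Arithmetic

%≡⇒≡/*+ : ∀ n d .{{_ : ℕ.NonZero d}} {r} → n % d ≡ r → n ≡ n ℕ./ d ℕ.* d ℕ.+ r
%≡⇒≡/*+ n d {r} eq = trans (ℕ.m≡m%n+[m/n]*n n d) (trans (cong (ℕ._+ n ℕ./ d ℕ.* d) eq) (ℕ.+-comm r _))

theorem1 : (n : ℕ) → n > 0 → (σ : Permutation′ (F n)) → IsKronecker φ φ-irrational σ →
    (n % 2 ≡ 0 → ∀ i → CycleLength σ 2 i ⊎ CycleLength σ 1 i)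
    × (n % 6 ≡ 1 ⊎ n % 6 ≡ 5 →
    (∀ i → CycleLength σ 4 i ⊎ CycleLength σ 1 i) × ∃! (SameCycle σ) (CycleLength σ 1))
    × (n % 6 ≡ 3 →
    (∀ i → CycleLength σ 4 i ⊎ CycleLength σ 2 i) × ∃! (SameCycle σ) (CycleLength σ 2))
theorem1 (suc m) _ σ kron =
    (λ n%2≡0 → let norm≡1 , 0<b = even-index (suc m ℕ./ 2) (trans (%≡⇒≡/*+ (suc m) 2 n%2≡0) (ℕ.+-identityʳ _)) in
      kronecker-even (F m) (F (suc m)) (0<F m) σ kron norm≡1 0<b)
  -- The residues are written `1 + 2 h` with `h` equal to 0 and 2; the parity witnesses come from
  -- `F 1 = 1 + 2 * 0` and `F 5 = 1 + 2 * 2`.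
  , [ N-odd 0 (0 , refl) , N-odd 2 (2 , refl) ]′
  , (λ n%6≡3 → kronecker-odd-N-even (F m) (F (suc m)) (0<F m) σ kron (norm≡-1 1 n%6≡3) (F≤F-suc m)
      -- The witness 1 stands for `F 3 = 2 * 1`.
      (subst (λ n → Even (F n)) (sym (%≡⇒≡/*+ (suc m) 6 n%6≡3)) (F-even-periodic (suc m ℕ./ 6) (1 , refl))))
  where
  even-index : ∀ q → suc m ≡ q ℕ.* 2 → fibNorm (F m) (F (suc m)) ≡ + 1 × 0 ℕ.< F m
  -- The index is positive and even, so `m` is `1 + q * 2`, which makes `F m` positive.
  even-index (suc q) refl = cassini-even q , 0<F (q ℕ.* 2)

  norm≡-1 : ∀ h → suc m % 6 ≡ suc (h ℕ.* 2) → fibNorm (F m) (F (suc m)) ≡ - (+ 1)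
  norm≡-1 h eq = subst (λ m → fibNorm (F m) (F (suc m)) ≡ - (+ 1)) (sym m≡) (cassini-odd (q ℕ.* 3 ℕ.+ h))
    where
    q = suc m ℕ./ 6
    m≡ : m ≡ (q ℕ.* 3 ℕ.+ h) ℕ.* 2
    m≡ = ℕ.suc-injective (trans (%≡⇒≡/*+ (suc m) 6 eq)
      (solve 2 (λ q h → q :* con 6 :+ (con 1 :+ h :* con 2) := con 1 :+ (q :* con 3 :+ h) :* con 2) refl q h))
      where open ℕSolver.+-*-Solver

  N-odd : ∀ h → Odd (F (suc (h ℕ.* 2))) → suc m % 6 ≡ suc (h ℕ.* 2) →
    (∀ i → CycleLength σ 4 i ⊎ CycleLength σ 1 i) × ∃! (SameCycle σ) (CycleLength σ 1)
  N-odd h odd eq = kronecker-odd-N-odd (F m) (F (suc m)) (0<F m) σ kron (norm≡-1 h eq) (F≤F-suc m)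
    (subst (λ n → Odd (F n)) (sym (%≡⇒≡/*+ (suc m) 6 eq)) (F-odd-periodic (suc m ℕ./ 6) odd))
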